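{- Let $G$ be a topological group, let $\mathfrak E$ be a $G$-spectrum, let $\mathfrak M$ be a Mackey cover of $\mathfrak E$ and let $C:\mathfrak M\to\mathsf{TAb}$ be a Mackey functor. Then the map $\mathrm{ind}^C_{\mathfrak E}:(H,U)\mapsto\mathrm{ind}^C_{H,U}C(U)$ ($(H,U)\in\mathfrak E_{\mathrm b}$) is a subfunctor of $C^{\mathfrak E}\in\mathsf{Fct}(\mathfrak E,\mathsf{TAb})$, and consequently $C^{\mathfrak E}/\mathrm{ind}^C_{\mathfrak E}$ is a representation of $\mathfrak E$.
   Context: $\mathsf{TAb}$ is the category of topological abelian groups. ${}^gH=gHg^{ -1}$, $H^g=g^{ -1}Hg$. RIC-functors. A RIC-domain $\mathfrak D$ consists of a non-empty set $\mathfrak D_{\mathrm b}$ with a left action $(g,x)\mapsto{}^gx$ of a group $G$ and, for each $x\in\mathfrak D_{\mathrm b}$, subsets $\mathfrak D_{\mathrm r}(x),\mathfrak D_{\mathrm i}(x)\subseteq\mathfrak D_{\mathrm b}$ such that for $\star\in\{\mathrm r,\mathrm i\}$: $x\in\mathfrak D_\star(x)$; $y\in\mathfrak D_\star(x)$ implies $\mathfrak D_\star(y)\subseteq\mathfrak D_\star(x)$; ${}^g\mathfrak D_\star(x)=\mathfrak D_\star({}^gx)$. A RIC-functor $\Phi:\mathfrak D\to\mathcal C$ consists of objects $\Phi(x)$ and morphisms $\mathrm{res}_{y,x}:\Phi(x)\to\Phi(y)$ ($y\in\mathfrak D_{\mathrm r}(x)$), $\mathrm{ind}_{x,y}:\Phi(y)\to\Phi(x)$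 ($y\in\mathfrak D_{\mathrm i}(x)$), $\mathrm{con}_{g,x}:\Phi(x)\to\Phi({}^gx)$ such that $\mathrm{res}_{x,x}=\mathrm{ind}_{x,x}=\mathrm{con}_{1,x}=\mathrm{id}$; $\mathrm{res}_{z,y}\mathrm{res}_{y,x}=\mathrm{res}_{z,x}$, $\mathrm{ind}_{x,y}\mathrm{ind}_{y,z}=\mathrm{ind}_{x,z}$, $\mathrm{con}_{g',{}^gx}\mathrm{con}_{g,x}=\mathrm{con}_{g'g,x}$; $\mathrm{con}_{g,y}\mathrm{res}_{y,x}=\mathrm{res}_{{}^gy,{}^gx}\mathrm{con}_{g,x}$ and $\mathrm{con}_{g,x}\mathrm{ind}_{x,y}=\mathrm{ind}_{{}^gx,{}^gy}\mathrm{con}_{g,y}$. $\mathsf{Fct}(\mathfrak D,\mathcal C)$ is the category of these. A subfunctor of $\Phi\in\mathsf{Fct}(\mathfrak D,\mathsf{TAb})$ is a family of subgroups $\Phi'(x)\le\Phi(x)$ stable under res, ind and con. A $G$-subgroup system is a RIC-domain $\mathfrak S$ where $\mathfrak S_{\mathrm b}$ is a set of subgroups of $G$ with the conjugation action and $I\le H$ for $I\in\mathfrak S_\star(H)$; $\mathfrak S'\le\mathfrak S$ means $\mathfrak S'_{\mathrm b}\subseteq\mathfrak S_{\mathrm b}$, $\mathfrak S'_\star(H)\subseteq\mathfrak S_\star(H)$. It is a $G$-Mackey system if for $I\in\mathfrak S_{\mathrm r}(H)$, $J\in\mathfrak S_{\mathrm i}(H)$ the set $I\backslash H/J$ is finite,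 $I\cap J\in\mathfrak S_{\mathrm r}(J)$ and $I\cap J\in\mathfrak S_{\mathrm i}(I)$. A Mackey functor on a Mackey system is a RIC-functor with $\mathrm{con}_{h,H}=\mathrm{id}$ for $h\in H$ and $\mathrm{res}_{I,H}\mathrm{ind}_{H,J}=\sum_{h}\mathrm{ind}_{I,I\cap{}^hJ}\,\mathrm{con}_{h,I^h\cap J}\,\mathrm{res}_{I^h\cap J,J}$ ($h$ over representatives of $I\backslash H/J$). A two-dimensional $G$-subgroup system is a RIC-domain $\mathfrak E$ with $\mathfrak E_{\mathrm b}$ a set of pairs $(H,U)$ ($H$ closed subgroup of $G$, $U$ closed normal subgroup of $H$) with componentwise conjugation and $I\le H$, $V\le U$ for $(I,V)\in\mathfrak E_\star(H,U)$. $\mathfrak E^\flat_{\mathrm b}$ is the set of first components of $\mathfrak E_{\mathrm b}$, $\mathrm{Ext}(\mathfrak E,H)=\{U:(H,U)\in\mathfrak E_{\mathrm b}\}$, $\mathfrak E^\flat_\star(H)$ the set of first components of $\bigcup_U\mathfrak E_\star(H,U)$. $\mathfrak E$ is a $G$-spectrum if $\mathfrak E^\flat$ is a $G$-subgroup system, $(I,V)\in\mathfrak E_{\mathrm r}(H,U)$ implies $V=U$, and $[H:I]<\infty$ for $I\in\mathfrak E^\flat_{\mathrm r}(H)$. A Mackey cover of $\mathfrak E$ is a $G$-Mackey system $\mathfrak M$ with $\mathfrak E^\flat\le\mathfrak M$, $\mathrm{Ext}(\mathfrak E,H)\subseteq\mathfrak M_{\mathrm i}(H)$ for $H\in\mathfrak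 E^\flat_{\mathrm b}$, and $V\in\mathfrak M_{\mathrm i}(U)$ whenever $(I,V)\in\mathfrak E_{\mathrm i}(H,U)$. $C^{\mathfrak E}(H,U)=C(H)$ with the res, ind, con of $C$ on first components. A representation of $\mathfrak E$ is a quotient functor $B^{\mathfrak E}/\Phi$ (values $B(H)/\Phi(H,U)$ with induced maps) with $B\in\mathsf{Fct}(\mathfrak E^\flat,\mathsf{TAb})$ and $\Phi$ a subfunctor of $B^{\mathfrak E}$. -}

module Defs where

open import Algebra.Bundles using (Group; AbelianGroup)
open import Algebra.Morphism.Structures using (module GroupMorphisms)
import Algebra.Morphism.Construct.Composition as Composition
import Algebra.Morphism.Construct.Identity as Identity
import Algebra.Properties.AbelianGroup as AbelianGroupProperties
import Algebra.Properties.CommutativeMonoid.Sum as Sum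
import Algebra.Properties.Group as GroupProperties
open import Data.Fin.Base using (Fin)
open import Data.Nat.Base using (ℕ)
open import Data.Product.Base using (Σ; Σ-syntax; ∃; ∃₂; _×_; _,_; proj₁; proj₂; uncurry)
open import Data.Product.Relation.Binary.Pointwise.NonDependent using (×-setoid)
open import Data.Unit.Polymorphic.Base using (⊤; tt)
open import Function.Base using (_∘_; _on_)
open import Function.Bundles using (Bijection)
open import Level using (Level; _⊔_) renaming (suc to lsuc)
open import Relation.Binary.Bundles using (Setoid)
open import Relation.Binary.Core using (Rel)
open import Relation.Binary.Definitions using (_Respects_)
open import Relation.Binary.PropositionalEquality.Core using (_≡_)
import Relation.Binary.PropositionalEquality.Properties as ≡
import Relation.Binary.Reasoning.Setoid as SetoidReasoning
open import Relation.Unary using (Pred; _⊆_; _≐_; _∩_; ∁; ⋃)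
open import Relation.Unary.Properties using (≐-refl; ≐-sym; ≐-trans)

-- A topology on a setoid: open sets are ≈-invariant predicates.  Keeping
-- carriers, equalities, predicates and the index types of unions at one
-- level ℓ makes "P is open iff it is a neighbourhood of all its points"
-- available predicatively.
record Topology {ℓ : Level} (S : Setoid ℓ ℓ) : Set (lsuc (lsuc ℓ)) where
  open Setoid S using (Carrier; _≈_)
  field
    Open       : Pred (Pred Carrier ℓ) (lsuc ℓ)
    Open-≐     : ∀ {P Q} → P ≐ Q → Open P → Open Q
    Open⇒resp  : ∀ {P} → Open P → P Respects _≈_
    Open-⊤     : Open (λ _ → ⊤)
    Open-∩     : ∀ {P Q} → Open P → Open Q → Open (P ∩ Q)
    Open-⋃     : {I : Set ℓ} (P : I → Pred Carrier ℓ) → (∀ i → Open (P i)) → Open (⋃ I P)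

  Closed : Pred (Pred Carrier ℓ) (lsuc ℓ)
  Closed P = (P Respects _≈_) × Open (∁ P)

  _ClosedIn_ : Rel (Pred Carrier ℓ) (lsuc ℓ)
  P ClosedIn Y = ∃ λ K → Closed K × P ≐ (Y ∩ K)

  neighbourhoods⇒Open : ∀ {P} → (∀ {x} → P x → ∃ λ V → Open V × V x × V ⊆ P) → Open P
  neighbourhoods⇒Open {P} nbd = Open-≐
    ( (λ (i , Vy) → proj₂ (proj₂ (proj₂ (nbd (proj₂ i)))) Vy)
    , (λ {x} Px → (x , Px) , proj₁ (proj₂ (proj₂ (nbd Px)))) )
    (Open-⋃ {I = ∃ P} (λ i → proj₁ (nbd (proj₂ i))) (λ i → proj₁ (proj₂ (nbd (proj₂ i)))))

_×ₜ_ : ∀ {ℓ} {S T : Setoid ℓ ℓ} → Topology S → Topology T → Topology (×-setoid S T)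
_×ₜ_ {ℓ} {S} {T} σ τ = record
  { Open      = λ P → ∀ {x y} → P (x , y) → ∃₂ λ V W →
                  σ.Open V × τ.Open W × V x × W y × (∀ {x′ y′} → V x′ → W y′ → P (x′ , y′))
  ; Open-≐    = λ (P⊆Q , Q⊆P) oP Qxy →
                  let V , W , oV , oW , Vx , Wy , inc = oP (Q⊆P Qxy)
                  in V , W , oV , oW , Vx , Wy , λ v w → P⊆Q (inc v w)
  ; Open⇒resp = λ oP (x≈x′ , y≈y′) Pxy →
                  let V , W , oV , oW , Vx , Wy , inc = oP Pxy
                  in inc (σ.Open⇒resp oV x≈x′ Vx) (τ.Open⇒resp oW y≈y′ Wy)
  ; Open-⊤    = λ _ → _ , _ , σ.Open-⊤ , τ.Open-⊤ , tt , tt , λ _ _ → tt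
  ; Open-∩    = λ oP oQ (Pxy , Qxy) →
                  let V , W , oV , oW , Vx , Wy , inc = oP Pxy
                      V′ , W′ , oV′ , oW′ , V′x , W′y , inc′ = oQ Qxy
                  in V ∩ V′ , W ∩ W′ , σ.Open-∩ oV oV′ , τ.Open-∩ oW oW′ , (Vx , V′x) , (Wy , W′y) ,
                     λ (v , v′) (w , w′) → inc v w , inc′ v′ w′
  ; Open-⋃    = λ P oP (i , Pxy) →
                  let V , W , oV , oW , Vx , Wy , inc = oP i Pxy
                  in V , W , oV , oW , Vx , Wy , λ v w → i , inc v w
  }
  where
  module σ = Topology σ
  module τ = Topology τ

Continuous : ∀ {ℓ} {S T : Setoid ℓ ℓ} → Topology S → Topology T →
             (Setoid.Carrier S → Setoid.Carrier T) → Set (lsuc ℓ)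
Continuous σ τ f = ∀ {P} → Topology.Open τ P → Topology.Open σ (P ∘ f)

record IsTopologicalGroup {ℓ : Level} (G : Group ℓ ℓ) (τ : Topology (Group.setoid G)) :
                          Set (lsuc ℓ) where
  open Group G using (_∙_; _⁻¹)
  field
    ∙-continuous  : Continuous (τ ×ₜ τ) τ (uncurry _∙_)
    ⁻¹-continuous : Continuous τ τ _⁻¹

record TopologicalGroup (ℓ : Level) : Set (lsuc (lsuc ℓ)) where
  field
    group              : Group ℓ ℓ
    topology           : Topology (Group.setoid group)
    isTopologicalGroup : IsTopologicalGroup group topology
  open Topology topology public

record Subgroup {ℓ : Level} (G : Group ℓ ℓ) : Set (lsuc ℓ) where
  open Group G using (Carrier; _≈_; _∙_; ε; _⁻¹)
  field
    mem       : Pred Carrier ℓ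
    resp      : mem Respects _≈_
    ∙-closed  : ∀ {x y} → mem x → mem y → mem (x ∙ y)
    ε-closed  : mem ε
    ⁻¹-closed : ∀ {x} → mem x → mem (x ⁻¹)

open Subgroup using (mem)

module _ {ℓ : Level} {G : Group ℓ ℓ} where
  private module G = Group G
  open Group G using (Carrier; _≈_; _∙_; ε; _⁻¹)

  infix 4 _≤ˢ_ _≈ˢ_
  infixr 7 _∩ˢ_

  _≤ˢ_ _≈ˢ_ : Rel (Subgroup G) ℓ
  H ≤ˢ K = mem H ⊆ mem K
  H ≈ˢ K = mem H ≐ mem K

  _∩ˢ_ : Subgroup G → Subgroup G → Subgroup G
  H ∩ˢ K = record
    { mem       = mem H ∩ mem K
    ; resp      = λ eq (h , k) → H.resp eq h , K.resp eq k
    ; ∙-closed  = λ (h , k) (h′ , k′) → H.∙-closed h h′ , K.∙-closed k k′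
    ; ε-closed  = H.ε-closed , K.ε-closed
    ; ⁻¹-closed = λ (h , k) → H.⁻¹-closed h , K.⁻¹-closed k
    }
    where
    module H = Subgroup H
    module K = Subgroup K

  _⊴_ : Rel (Subgroup G) ℓ
  U ⊴ H = U ≤ˢ H × (∀ {h u} → mem H h → mem U u → mem U (h ∙ u ∙ h ⁻¹))

  ad : Carrier → Carrier → Carrier
  ad g x = g ∙ x ∙ g ⁻¹

  private
    open GroupProperties G
    open SetoidReasoning G.setoid

    ad-cong : ∀ {g h x y} → g ≈ h → x ≈ y → ad g x ≈ ad h y
    ad-cong e f = G.∙-cong (G.∙-cong e f) (G.⁻¹-cong e)

    ad-∙ : ∀ g x y → ad g x ∙ ad g y ≈ ad g (x ∙ y)
    ad-∙ g x y = begin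
      (g ∙ x ∙ g ⁻¹) ∙ (g ∙ y ∙ g ⁻¹)   ≈⟨ G.assoc _ _ _ ⟩
      g ∙ x ∙ (g ⁻¹ ∙ (g ∙ y ∙ g ⁻¹))   ≈⟨ G.∙-congˡ (G.∙-congˡ (G.assoc _ _ _)) ⟩
      g ∙ x ∙ (g ⁻¹ ∙ (g ∙ (y ∙ g ⁻¹))) ≈⟨ G.∙-congˡ (\\-leftDividesʳ g _) ⟩
      g ∙ x ∙ (y ∙ g ⁻¹)                ≈⟨ G.assoc _ _ _ ⟨
      g ∙ x ∙ y ∙ g ⁻¹                  ≈⟨ G.∙-congʳ (G.assoc _ _ _) ⟩
      g ∙ (x ∙ y) ∙ g ⁻¹                ∎

    ad-ε : ∀ g → ad g ε ≈ ε
    ad-ε g = G.trans (G.∙-congʳ (G.identityʳ g)) (G.inverseʳ g)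

    ad-⁻¹ : ∀ g x → ad g x ⁻¹ ≈ ad g (x ⁻¹)
    ad-⁻¹ g x = G.sym (inverseʳ-unique _ _
      (G.trans (ad-∙ g x (x ⁻¹)) (G.trans (ad-cong G.refl (G.inverseʳ x)) (ad-ε g))))

    ad-id : ∀ x → ad ε x ≈ x
    ad-id x = G.trans (G.∙-cong (G.identityˡ x) ε⁻¹≈ε) (G.identityʳ x)

    ad-ad : ∀ g h x → ad g (ad h x) ≈ ad (g ∙ h) x
    ad-ad g h x = begin
      g ∙ (h ∙ x ∙ h ⁻¹) ∙ g ⁻¹   ≈⟨ G.∙-congʳ (G.assoc _ _ _) ⟨
      g ∙ (h ∙ x) ∙ h ⁻¹ ∙ g ⁻¹   ≈⟨ G.assoc _ _ _ ⟩
      g ∙ (h ∙ x) ∙ (h ⁻¹ ∙ g ⁻¹) ≈⟨ G.∙-cong (G.assoc _ _ _) (⁻¹-anti-homo-∙ g h) ⟨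
      g ∙ h ∙ x ∙ (g ∙ h) ⁻¹      ∎

    ad-inv : ∀ g x → ad g (ad (g ⁻¹) x) ≈ x
    ad-inv g x = G.trans (ad-ad _ _ _) (G.trans (ad-cong (G.inverseʳ g) G.refl) (ad-id x))

    ad-inv′ : ∀ g x → ad (g ⁻¹) (ad g x) ≈ x
    ad-inv′ g x = G.trans (ad-ad _ _ _) (G.trans (ad-cong (G.inverseˡ g) G.refl) (ad-id x))

  -- ᵍH = gHg⁻¹
  conj : Carrier → Subgroup G → Subgroup G
  conj g H = record
    { mem       = λ x → ∃ λ h → mem H h × x ≈ ad g h
    ; resp      = λ x≈y (h , Hh , x≈) → h , Hh , G.trans (G.sym x≈y) x≈
    ; ∙-closed  = λ (h , Hh , x≈) (k , Hk , y≈) →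
                    h ∙ k , H.∙-closed Hh Hk , G.trans (G.∙-cong x≈ y≈) (ad-∙ g h k)
    ; ε-closed  = ε , H.ε-closed , G.sym (ad-ε g)
    ; ⁻¹-closed = λ (h , Hh , x≈) → h ⁻¹ , H.⁻¹-closed Hh , G.trans (G.⁻¹-cong x≈) (ad-⁻¹ g h)
    }
    where module H = Subgroup H

  conj-cong : ∀ {g h H K} → g ≈ h → H ≈ˢ K → conj g H ≈ˢ conj h K
  conj-cong e (H≤K , K≤H) =
    (λ (h , Hh , x≈) → h , H≤K Hh , G.trans x≈ (ad-cong e G.refl)) ,
    (λ (h , Kh , x≈) → h , K≤H Kh , G.trans x≈ (ad-cong (G.sym e) G.refl))

  conj-identity : ∀ H → conj ε H ≈ˢ H
  conj-identity H =
    (λ (h , Hh , x≈) → Subgroup.resp H (G.sym (G.trans x≈ (ad-id h))) Hh) ,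
    (λ {x} Hx → x , Hx , G.sym (ad-id x))

  conj-conj : ∀ g h H → conj g (conj h H) ≈ˢ conj (g ∙ h) H
  conj-conj g h H =
    (λ (y , (z , Hz , y≈) , x≈) → z , Hz , G.trans x≈ (G.trans (ad-cong G.refl y≈) (ad-ad g h z))) ,
    (λ (z , Hz , x≈) → ad h z , (z , Hz , G.refl) , G.trans x≈ (G.sym (ad-ad g h z)))

  conj-self : ∀ {h} H → mem H h → conj h H ≈ˢ H
  conj-self {h} H Hh =
    (λ (k , Hk , x≈) → H.resp (G.sym x≈) (H.∙-closed (H.∙-closed Hh Hk) (H.⁻¹-closed Hh))) ,
    (λ {x} Hx → ad (h ⁻¹) x ,
                H.∙-closed (H.∙-closed (H.⁻¹-closed Hh) Hx) (H.⁻¹-closed (H.⁻¹-closed Hh)) ,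
                G.sym (ad-inv h x))
    where module H = Subgroup H

  -- Hᵍ = g⁻¹Hg
  _^ˢ_ : Subgroup G → Carrier → Subgroup G
  H ^ˢ g = conj (g ⁻¹) H

  conj-∩ : ∀ h I J → conj h ((I ^ˢ h) ∩ˢ J) ≈ˢ (I ∩ˢ conj h J)
  conj-∩ h I J =
    (λ (y , ((i , Ii , y≈) , Jy) , x≈) →
       Subgroup.resp I (G.sym (G.trans x≈ (G.trans (ad-cong G.refl y≈) (ad-inv h i)))) Ii ,
       (y , Jy , x≈)) ,
    (λ {x} (Ix , (j , Jj , x≈)) →
       j , ((x , Ix , G.trans (G.sym (ad-inv′ h j)) (ad-cong G.refl (G.sym x≈))) , Jj) , x≈)

  LeftCosets : Subgroup G → Subgroup G → Setoid ℓ ℓ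
  LeftCosets H I = record
    { Carrier = ∃ (mem H)
    ; _≈_     = λ (x , _) (y , _) → ∃ λ i → mem I i × y ≈ x ∙ i
    ; isEquivalence = record
      { refl  = ε , I.ε-closed , G.sym (G.identityʳ _)
      ; sym   = λ (i , Ii , y≈) → i ⁻¹ , I.⁻¹-closed Ii , x≈z//y _ _ _ (G.sym y≈)
      ; trans = λ (i , Ii , y≈) (j , Ij , z≈) →
          i ∙ j , I.∙-closed Ii Ij , G.trans z≈ (G.trans (G.∙-congʳ y≈) (G.assoc _ _ _))
      }
    }
    where module I = Subgroup I

  DoubleCosets : Subgroup G → Subgroup G → Subgroup G → Setoid ℓ ℓ
  DoubleCosets I H J = record
    { Carrier = ∃ (mem H)
    ; _≈_     = λ (x , _) (y , _) → ∃₂ λ i j → mem I i × mem J j × y ≈ i ∙ x ∙ j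
    ; isEquivalence = record
      { refl  = ε , ε , I.ε-closed , J.ε-closed ,
                G.sym (G.trans (G.identityʳ _) (G.identityˡ _))
      ; sym   = λ {(x , _)} {(y , _)} (i , j , Ii , Jj , y≈) →
          i ⁻¹ , j ⁻¹ , I.⁻¹-closed Ii , J.⁻¹-closed Jj , (begin
            x                           ≈⟨ \\-leftDividesʳ i x ⟨
            i ⁻¹ ∙ (i ∙ x)              ≈⟨ //-rightDividesʳ j _ ⟨
            i ⁻¹ ∙ (i ∙ x) ∙ j ∙ j ⁻¹   ≈⟨ G.∙-congʳ (G.assoc _ _ _) ⟩
            i ⁻¹ ∙ (i ∙ x ∙ j) ∙ j ⁻¹   ≈⟨ G.∙-congʳ (G.∙-congˡ y≈) ⟨
            i ⁻¹ ∙ y ∙ j ⁻¹             ∎)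
      ; trans = λ {(x , _)} {(y , _)} {(z , _)} (i , j , Ii , Jj , y≈) (i′ , j′ , Ii′ , Jj′ , z≈) →
          i′ ∙ i , j ∙ j′ , I.∙-closed Ii′ Ii , J.∙-closed Jj Jj′ , (begin
            z                        ≈⟨ z≈ ⟩
            i′ ∙ y ∙ j′              ≈⟨ G.∙-congʳ (G.∙-congˡ y≈) ⟩
            i′ ∙ (i ∙ x ∙ j) ∙ j′    ≈⟨ G.∙-congʳ (G.assoc _ _ _) ⟨
            i′ ∙ (i ∙ x) ∙ j ∙ j′    ≈⟨ G.assoc _ _ _ ⟩
            i′ ∙ (i ∙ x) ∙ (j ∙ j′)  ≈⟨ G.∙-congʳ (G.assoc _ _ _) ⟨
            i′ ∙ i ∙ x ∙ (j ∙ j′)    ∎)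
      }
    }
    where
    module I = Subgroup I
    module J = Subgroup J

-- For a setoid of cosets such a bijection is a system of representatives.
Enumeration : ∀ {c ℓ} → Setoid c ℓ → ℕ → Set (c ⊔ ℓ)
Enumeration S n = Bijection (≡.setoid (Fin n)) S

Finite : ∀ {c ℓ} → Setoid c ℓ → Set (c ⊔ ℓ)
Finite S = ∃ λ n → Enumeration S n

record TAb (a : Level) : Set (lsuc (lsuc a)) where
  field
    abelianGroup       : AbelianGroup a a
    topology           : Topology (AbelianGroup.setoid abelianGroup)
    isTopologicalGroup : IsTopologicalGroup (AbelianGroup.group abelianGroup) topology
  open AbelianGroup abelianGroup public
  open Topology topology public
  open IsTopologicalGroup isTopologicalGroup public

record Hom {a : Level} (A B : TAb a) : Set (lsuc a) where
  private
    module A = TAb A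
    module B = TAb B
  open GroupMorphisms A.rawGroup B.rawGroup using (IsGroupHomomorphism)
  field
    ⟦_⟧                 : A.Carrier → B.Carrier
    isGroupHomomorphism : IsGroupHomomorphism ⟦_⟧
    continuous          : Continuous A.topology B.topology ⟦_⟧
  open GroupMorphisms.IsGroupHomomorphism isGroupHomomorphism public

open Hom using (⟦_⟧)

module _ {a : Level} where

  infix 4 _≋_
  infixr 9 _∘ₜ_

  _≋_ : {A B : TAb a} → Rel (Hom A B) a
  _≋_ {B = B} f g = ∀ x → TAb._≈_ B (⟦ f ⟧ x) (⟦ g ⟧ x)

  idₜ : {A : TAb a} → Hom A A
  idₜ {A} = record
    { ⟦_⟧                 = λ x → x
    ; isGroupHomomorphism = Identity.isGroupHomomorphism (TAb.rawGroup A) (TAb.refl A)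
    ; continuous          = λ oP → oP
    }

  _∘ₜ_ : {A B C : TAb a} → Hom B C → Hom A B → Hom A C
  _∘ₜ_ {C = C} g f = record
    { ⟦_⟧                 = ⟦ g ⟧ ∘ ⟦ f ⟧
    ; isGroupHomomorphism = Composition.isGroupHomomorphism (TAb.trans C)
                              (Hom.isGroupHomomorphism f) (Hom.isGroupHomomorphism g)
    ; continuous          = Hom.continuous f ∘ Hom.continuous g
    }

  SubgroupOf : TAb a → Set (lsuc a)
  SubgroupOf A = Subgroup (TAb.group A)

  image : {A B : TAb a} → Hom A B → SubgroupOf B
  image {A} {B} f = record
    { mem       = λ y → ∃ λ x → ⟦ f ⟧ x B.≈ y
    ; resp      = λ y≈z (x , e) → x , B.trans e y≈z
    ; ∙-closed  = λ (x , e) (x′ , e′) → x A.∙ x′ , B.trans (f.homo x x′) (B.∙-cong e e′)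
    ; ε-closed  = A.ε , f.ε-homo
    ; ⁻¹-closed = λ (x , e) → x A.⁻¹ , B.trans (f.⁻¹-homo x) (B.⁻¹-cong e)
    }
    where
    module A = TAb A
    module B = TAb B
    module f = Hom f

  -- A / N keeps the carrier of A; equality is x y⁻¹ ∈ N, and the open sets of
  -- the quotient topology are the open sets of A invariant under this equality.
  _/ₜ_ : (A : TAb a) → SubgroupOf A → TAb a
  A /ₜ N = record
    { abelianGroup = abelianGroup
    ; topology     = topology
    ; isTopologicalGroup = record
      { ∙-continuous  = λ {P} (rP , oP) {x} {y} Pxy →
          let V , W , oV , oW , Vx , Wy , inc = A.∙-continuous oP Pxy
          in sat V , sat W , sat-open oV , sat-open oW ,
             sat-incl oV Vx , sat-incl oW Wy ,
             λ { {x′} {y′} ((n , Nn) , v) ((m , Nm) , w) →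
               rP (sym (cong∙ {x′} {x′ A.∙ n} {y′} {y′ A.∙ m} (shift x′ Nn) (shift y′ Nm))) (inc v w) }
      ; ⁻¹-continuous = λ (rP , oP) →
          (λ {x} {y} x~y → rP (cong⁻¹ {x} {y} x~y)) , A.⁻¹-continuous oP
      }
    }
    where
    module A = TAb A
    module N = Subgroup N
    open AbelianGroupProperties A.abelianGroup
    open SetoidReasoning A.setoid

    _~_ : Rel A.Carrier a
    x ~ y = mem N (x A.∙ y A.⁻¹)

    reflexive : ∀ {x y} → x A.≈ y → x ~ y
    reflexive x≈y = N.resp (A.sym (x≈y⇒x∙y⁻¹≈ε x≈y)) N.ε-closed

    sym : ∀ {x y} → x ~ y → y ~ x
    sym {x} {y} n = N.resp
      (A.trans (⁻¹-anti-homo-∙ x (y A.⁻¹)) (A.∙-congʳ (⁻¹-involutive y))) (N.⁻¹-closed n)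

    trans : ∀ {x y z} → x ~ y → y ~ z → x ~ z
    trans {x} {y} {z} n m = N.resp (begin
      x A.∙ y A.⁻¹ A.∙ (y A.∙ z A.⁻¹)   ≈⟨ A.assoc _ _ _ ⟩
      x A.∙ (y A.⁻¹ A.∙ (y A.∙ z A.⁻¹)) ≈⟨ A.∙-congˡ (\\-leftDividesʳ y _) ⟩
      x A.∙ z A.⁻¹                      ∎) (N.∙-closed n m)

    cong∙ : ∀ {x x′ y y′} → x ~ x′ → y ~ y′ → (x A.∙ y) ~ (x′ A.∙ y′)
    cong∙ {x} {x′} {y} {y′} n m = N.resp (begin
      x A.∙ x′ A.⁻¹ A.∙ (y A.∙ y′ A.⁻¹)     ≈⟨ A.assoc _ _ _ ⟩
      x A.∙ (x′ A.⁻¹ A.∙ (y A.∙ y′ A.⁻¹))   ≈⟨ A.∙-congˡ (A.comm _ _) ⟩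
      x A.∙ (y A.∙ y′ A.⁻¹ A.∙ x′ A.⁻¹)     ≈⟨ A.∙-congˡ (A.assoc _ _ _) ⟩
      x A.∙ (y A.∙ (y′ A.⁻¹ A.∙ x′ A.⁻¹))   ≈⟨ A.assoc _ _ _ ⟨
      x A.∙ y A.∙ (y′ A.⁻¹ A.∙ x′ A.⁻¹)     ≈⟨ A.∙-congˡ (⁻¹-anti-homo-∙ x′ y′) ⟨
      x A.∙ y A.∙ (x′ A.∙ y′) A.⁻¹          ∎) (N.∙-closed n m)

    cong⁻¹ : ∀ {x y} → x ~ y → (x A.⁻¹) ~ (y A.⁻¹)
    cong⁻¹ {x} {y} n = N.resp (A.sym (⁻¹-∙-comm x (y A.⁻¹))) (N.⁻¹-closed n)

    shift : ∀ x {n} → mem N n → x ~ (x A.∙ n)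
    shift x {n} Nn = N.resp (A.sym (begin
      x A.∙ (x A.∙ n) A.⁻¹          ≈⟨ A.∙-congˡ (A.⁻¹-cong (A.comm x n)) ⟩
      x A.∙ (n A.∙ x) A.⁻¹          ≈⟨ A.∙-congˡ (⁻¹-anti-homo-∙ n x) ⟩
      x A.∙ (x A.⁻¹ A.∙ n A.⁻¹)     ≈⟨ \\-leftDividesˡ x _ ⟩
      n A.⁻¹                        ∎)) (N.⁻¹-closed Nn)

    abelianGroup : AbelianGroup a a
    abelianGroup = record
      { Carrier = A.Carrier ; _≈_ = _~_ ; _∙_ = A._∙_ ; ε = A.ε ; _⁻¹ = A._⁻¹
      ; isAbelianGroup = record
        { isGroup = record
          { isMonoid = record
            { isSemigroup = record
              { isMagma = record
                { isEquivalence = record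
                  { refl  = λ {x} → reflexive {x} A.refl
                  ; sym   = λ {x} {y} → sym {x} {y}
                  ; trans = λ {x} {y} {z} → trans {x} {y} {z}
                  }
                ; ∙-cong = λ {x} {x′} {y} {y′} → cong∙ {x} {x′} {y} {y′}
                }
              ; assoc = λ x y z → reflexive (A.assoc x y z)
              }
            ; identity = (λ x → reflexive (A.identityˡ x)) , (λ x → reflexive (A.identityʳ x))
            }
          ; inverse = (λ x → reflexive (A.inverseˡ x)) , (λ x → reflexive (A.inverseʳ x))
          ; ⁻¹-cong = λ {x} {y} → cong⁻¹ {x} {y}
          }
        ; comm = λ x y → reflexive (A.comm x y)
        }
      }

    topology : Topology (AbelianGroup.setoid abelianGroup)
    topology = record
      { Open      = λ P → (P Respects _~_) × A.Open P
      ; Open-≐    = λ (P⊆Q , Q⊆P) (rP , oP) →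
                      (λ {x} {y} x~y Qx → P⊆Q (rP {x} {y} x~y (Q⊆P Qx))) , A.Open-≐ (P⊆Q , Q⊆P) oP
      ; Open⇒resp = λ (rP , _) {x} {y} → rP {x} {y}
      ; Open-⊤    = (λ _ _ → tt) , A.Open-⊤
      ; Open-∩    = λ (rP , oP) (rQ , oQ) →
                      (λ {x} {y} x~y (Px , Qx) → rP {x} {y} x~y Px , rQ {x} {y} x~y Qx) , A.Open-∩ oP oQ
      ; Open-⋃    = λ P oP →
                      (λ {x} {y} x~y (i , Px) → i , proj₁ (oP i) {x} {y} x~y Px) ,
                      A.Open-⋃ P (proj₂ ∘ oP)
      }

    sat : Pred A.Carrier a → Pred A.Carrier a
    sat V = ⋃ (∃ (mem N)) λ (n , _) x → V (x A.∙ n)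

    translate-open : ∀ {V} c → A.Open V → A.Open (λ x → V (x A.∙ c))
    translate-open c oV = A.neighbourhoods⇒Open λ Vxc →
      let W , W′ , oW , _ , Wx , W′c , inc = A.∙-continuous oV Vxc
      in W , oW , Wx , λ w → inc w W′c

    sat-open : ∀ {V} → A.Open V → Topology.Open topology (sat V)
    sat-open oV =
      (λ {x} {y} x~y ((n , Nn) , Vxn) →
         (x A.∙ y A.⁻¹ A.∙ n , N.∙-closed x~y Nn) ,
         A.Open⇒resp oV (begin
           x A.∙ n                              ≈⟨ A.∙-congʳ (\\-leftDividesˡ y x) ⟨
           y A.∙ (y A.⁻¹ A.∙ x) A.∙ n           ≈⟨ A.assoc _ _ _ ⟩
           y A.∙ (y A.⁻¹ A.∙ x A.∙ n)           ≈⟨ A.∙-congˡ (A.∙-congʳ (A.comm _ _)) ⟩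
           y A.∙ (x A.∙ y A.⁻¹ A.∙ n)           ∎) Vxn) ,
      A.Open-⋃ _ (λ (n , _) → translate-open n oV)

    sat-incl : ∀ {V} → A.Open V → V ⊆ sat V
    sat-incl oV Vx = (A.ε , N.ε-closed) , A.Open⇒resp oV (A.sym (A.identityʳ _)) Vx

  quotientHom : {A B : TAb a} (N : SubgroupOf A) (M : SubgroupOf B) (f : Hom A B) →
                (∀ {x} → mem N x → mem M (⟦ f ⟧ x)) → Hom (A /ₜ N) (B /ₜ M)
  quotientHom {A} {B} N M f stable = record
    { ⟦_⟧                 = ⟦ f ⟧
    ; isGroupHomomorphism = record
      { isMonoidHomomorphism = record
        { isMagmaHomomorphism = record
          { isRelHomomorphism = record { cong = λ {x} {y} → cong {x} {y} }
          ; homo = λ x y → lift (f.homo x y)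
          }
        ; ε-homo = lift f.ε-homo
        }
      ; ⁻¹-homo = λ x → lift (f.⁻¹-homo x)
      }
    ; continuous = λ (rP , oP) → (λ {x} {y} x~y → rP (cong {x} {y} x~y)) , f.continuous oP
    }
    where
    module A = TAb A
    module B = TAb B
    module f = Hom f
    module M = Subgroup M
    cong : ∀ {x y} → mem N (x A.∙ y A.⁻¹) → mem M (⟦ f ⟧ x B.∙ ⟦ f ⟧ y B.⁻¹)
    cong {x} {y} n = M.resp (B.trans (f.homo x (y A.⁻¹)) (B.∙-congˡ (f.⁻¹-homo y))) (stable n)
    lift : ∀ {x y} → x B.≈ y → mem M (x B.∙ y B.⁻¹)
    lift e = M.resp (B.sym (GroupProperties.x≈y⇒x∙y⁻¹≈ε B.group e)) M.ε-closed

record GSet {ℓ : Level} (G : Group ℓ ℓ) (c e : Level) : Set (ℓ ⊔ lsuc (c ⊔ e)) where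
  private module G = Group G
  field
    setoid : Setoid c e
  open Setoid setoid public
  infixr 8 _·_
  field
    _·_        : G.Carrier → Carrier → Carrier
    ·-cong     : ∀ {g h x y} → g G.≈ h → x ≈ y → (g · x) ≈ (h · y)
    ·-identity : ∀ x → (G.ε · x) ≈ x
    ·-assoc    : ∀ g h x → (g · h · x) ≈ ((g G.∙ h) · x)

data Kind : Set where
  𝔯 𝔦 : Kind

-- The base set 𝔇_b is presented as an invariant subset b of an ambient G-set
-- X (the subgroups of G, say), and D ⋆ x y means y ∈ 𝔇⋆(x).  Only the values
-- D ⋆ x with x ∈ b matter.
record RawRICDomain {ℓ c e : Level} {G : Group ℓ ℓ} (X : GSet G c e) (p : Level) :
                    Set (c ⊔ e ⊔ lsuc p) where
  open GSet X using (Carrier; _≈_)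
  field
    b      : Pred Carrier p
    b-resp : b Respects _≈_
    D      : Kind → Carrier → Pred Carrier p
    D-resp : ∀ ⋆ {x x′ y y′} → x ≈ x′ → y ≈ y′ → D ⋆ x y → D ⋆ x′ y′

record IsRICDomain {ℓ c e p : Level} {G : Group ℓ ℓ} {X : GSet G c e} (𝔇 : RawRICDomain X p) :
                   Set (ℓ ⊔ c ⊔ e ⊔ p) where
  open GSet X using (_≈_; _·_)
  open RawRICDomain 𝔇
  field
    nonempty : ∃ b
    b-act    : ∀ g {x} → b x → b (g · x)
    D⊆b      : ∀ ⋆ {x} → b x → D ⋆ x ⊆ b
    D-refl   : ∀ ⋆ {x} → b x → D ⋆ x x
    D-trans  : ∀ ⋆ {x y} → b x → D ⋆ x y → D ⋆ y ⊆ D ⋆ x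
    D-act    : ∀ ⋆ g {x} → b x → (λ z → ∃ λ y → D ⋆ x y × z ≈ (g · y)) ≐ D ⋆ (g · x)

record RICDomain {ℓ c e : Level} {G : Group ℓ ℓ} (X : GSet G c e) (p : Level) :
                 Set (ℓ ⊔ c ⊔ e ⊔ lsuc p) where
  field
    raw         : RawRICDomain X p
    isRICDomain : IsRICDomain raw
  open RawRICDomain raw public
  open IsRICDomain isRICDomain public

  private
    module G = Group G
    module X = GSet X

  El : Set (c ⊔ p)
  El = Σ X.Carrier b

  infix 4 _≈ᴱ_
  _≈ᴱ_ : Rel El e
  _≈ᴱ_ = X._≈_ on proj₁

  infixr 8 _·ᴱ_
  _·ᴱ_ : G.Carrier → El → El
  g ·ᴱ (x , bx) = g X.· x , b-act g bx

  Dᴱ : Kind → El → Pred El p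
  Dᴱ ⋆ x y = D ⋆ (proj₁ x) (proj₁ y)

  D-act⁺ : ∀ ⋆ g {x y} → b x → D ⋆ x y → D ⋆ (g X.· x) (g X.· y)
  D-act⁺ ⋆ g bx Dxy = proj₁ (D-act ⋆ g bx) (_ , Dxy , X.refl)

-- The base set is a setoid, so the objects form a setoid-indexed family: tr
-- is the identification Φ(x) = Φ(y) for equal x and y.  It is independent of
-- the equality proof by tr-id and tr-∘, every piece of structure is invariant
-- under it, and it is inserted where the axioms need two values of Φ at equal
-- but not identical indices to be the same.
record RICFunctor {ℓ c e p : Level} {G : Group ℓ ℓ} {X : GSet G c e} (𝔇 : RICDomain X p)
                  (a : Level) : Set (ℓ ⊔ c ⊔ e ⊔ p ⊔ lsuc (lsuc a)) where
  private
    module G = Group G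
    module X = GSet X
  open RICDomain 𝔇
  field
    Obj : El → TAb a
    tr  : ∀ x y → x ≈ᴱ y → Hom (Obj x) (Obj y)
    res : ∀ y x → Dᴱ 𝔯 x y → Hom (Obj x) (Obj y)
    ind : ∀ x y → Dᴱ 𝔦 x y → Hom (Obj y) (Obj x)
    con : ∀ g x → Hom (Obj x) (Obj (g ·ᴱ x))

    tr-id  : ∀ {x} (e : x ≈ᴱ x) → tr x x e ≋ idₜ
    tr-∘   : ∀ {x y z} (e : x ≈ᴱ y) (f : y ≈ᴱ z) (h : x ≈ᴱ z) →
             tr y z f ∘ₜ tr x y e ≋ tr x z h
    res-tr : ∀ {x x′ y y′} (e : x ≈ᴱ x′) (f : y ≈ᴱ y′) (q : Dᴱ 𝔯 x y) (q′ : Dᴱ 𝔯 x′ y′) →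
             tr y y′ f ∘ₜ res y x q ≋ res y′ x′ q′ ∘ₜ tr x x′ e
    ind-tr : ∀ {x x′ y y′} (e : x ≈ᴱ x′) (f : y ≈ᴱ y′) (q : Dᴱ 𝔦 x y) (q′ : Dᴱ 𝔦 x′ y′) →
             tr x x′ e ∘ₜ ind x y q ≋ ind x′ y′ q′ ∘ₜ tr y y′ f
    con-tr : ∀ {g g′ x x′} → g G.≈ g′ → (e : x ≈ᴱ x′) (f : g ·ᴱ x ≈ᴱ g′ ·ᴱ x′) →
             tr (g ·ᴱ x) (g′ ·ᴱ x′) f ∘ₜ con g x ≋ con g′ x′ ∘ₜ tr x x′ e

    res-id : ∀ {x} (q : Dᴱ 𝔯 x x) → res x x q ≋ idₜ
    ind-id : ∀ {x} (q : Dᴱ 𝔦 x x) → ind x x q ≋ idₜ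
    con-id : ∀ x → tr (G.ε ·ᴱ x) x (X.·-identity (proj₁ x)) ∘ₜ con G.ε x ≋ idₜ

    res-∘  : ∀ {x y z} (q : Dᴱ 𝔯 x y) (s : Dᴱ 𝔯 y z) (t : Dᴱ 𝔯 x z) →
             res z y s ∘ₜ res y x q ≋ res z x t
    ind-∘  : ∀ {x y z} (q : Dᴱ 𝔦 x y) (s : Dᴱ 𝔦 y z) (t : Dᴱ 𝔦 x z) →
             ind x y q ∘ₜ ind y z s ≋ ind x z t
    con-∘  : ∀ g′ g x →
             tr (g′ ·ᴱ g ·ᴱ x) ((g′ G.∙ g) ·ᴱ x) (X.·-assoc g′ g (proj₁ x))
               ∘ₜ con g′ (g ·ᴱ x) ∘ₜ con g x
             ≋ con (g′ G.∙ g) x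

    con-res : ∀ g {x y} (q : Dᴱ 𝔯 x y) (s : Dᴱ 𝔯 (g ·ᴱ x) (g ·ᴱ y)) →
              con g y ∘ₜ res y x q ≋ res (g ·ᴱ y) (g ·ᴱ x) s ∘ₜ con g x
    con-ind : ∀ g {x y} (q : Dᴱ 𝔦 x y) (s : Dᴱ 𝔦 (g ·ᴱ x) (g ·ᴱ y)) →
              con g x ∘ₜ ind x y q ≋ ind (g ·ᴱ x) (g ·ᴱ y) s ∘ₜ con g y

module _ {ℓ c e p : Level} {G : Group ℓ ℓ} {X : GSet G c e} {𝔇 : RICDomain X p} {a : Level} where
  open RICDomain 𝔇

  record IsSubfunctor (Φ : RICFunctor 𝔇 a) (Φ′ : ∀ x → SubgroupOf (RICFunctor.Obj Φ x)) :
                      Set (ℓ ⊔ c ⊔ e ⊔ p ⊔ a) where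
    open RICFunctor Φ
    field
      tr-stable  : ∀ {x y} (q : x ≈ᴱ y) {m} → mem (Φ′ x) m → mem (Φ′ y) (⟦ tr x y q ⟧ m)
      res-stable : ∀ {x y} (q : Dᴱ 𝔯 x y) {m} → mem (Φ′ x) m → mem (Φ′ y) (⟦ res y x q ⟧ m)
      ind-stable : ∀ {x y} (q : Dᴱ 𝔦 x y) {m} → mem (Φ′ y) m → mem (Φ′ x) (⟦ ind x y q ⟧ m)
      con-stable : ∀ g {x m} → mem (Φ′ x) m → mem (Φ′ (g ·ᴱ x)) (⟦ con g x ⟧ m)

  quotientFunctor : (Φ : RICFunctor 𝔇 a) (Φ′ : ∀ x → SubgroupOf (RICFunctor.Obj Φ x)) →
                    IsSubfunctor Φ Φ′ → RICFunctor 𝔇 a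
  quotientFunctor Φ Φ′ stable = record
    { Obj     = λ x → Obj x /ₜ Φ′ x
    ; tr      = λ x y q → quotientHom (Φ′ x) (Φ′ y) (tr x y q) (tr-stable q)
    ; res     = λ y x q → quotientHom (Φ′ x) (Φ′ y) (res y x q) (res-stable q)
    ; ind     = λ x y q → quotientHom (Φ′ y) (Φ′ x) (ind x y q) (ind-stable q)
    ; con     = λ g x → quotientHom (Φ′ x) (Φ′ (g ·ᴱ x)) (con g x) (con-stable g)
    ; tr-id   = λ {x} q m → lift x (tr-id q m)
    ; tr-∘    = λ {x} {y} {z} q s t m → lift z (tr-∘ q s t m)
    ; res-tr  = λ {x} {x′} {y} {y′} q s t u m → lift y′ (res-tr q s t u m)
    ; ind-tr  = λ {x} {x′} {y} {y′} q s t u m → lift x′ (ind-tr q s t u m)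
    ; con-tr  = λ {g} {g′} {x} {x′} q s t m → lift (g′ ·ᴱ x′) (con-tr q s t m)
    ; res-id  = λ {x} q m → lift x (res-id q m)
    ; ind-id  = λ {x} q m → lift x (ind-id q m)
    ; con-id  = λ x m → lift x (con-id x m)
    ; res-∘   = λ {x} {y} {z} q s t m → lift z (res-∘ q s t m)
    ; ind-∘   = λ {x} {y} {z} q s t m → lift x (ind-∘ q s t m)
    ; con-∘   = λ g′ g x m → lift (_ ·ᴱ x) (con-∘ g′ g x m)
    ; con-res = λ g {x} {y} q s m → lift (g ·ᴱ y) (con-res g q s m)
    ; con-ind = λ g {x} {y} q s m → lift (g ·ᴱ x) (con-ind g q s m)
    }
    where
    open RICFunctor Φ
    open IsSubfunctor stable
    lift : ∀ x {m n} → TAb._≈_ (Obj x) m n → TAb._≈_ (Obj x /ₜ Φ′ x) m n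
    lift x q = Subgroup.resp (Φ′ x)
      (TAb.sym (Obj x) (GroupProperties.x≈y⇒x∙y⁻¹≈ε (TAb.group (Obj x)) q))
      (Subgroup.ε-closed (Φ′ x))

record DomainMap {ℓ c e p c′ e′ p′ : Level} {G : Group ℓ ℓ} {X : GSet G c e} {Y : GSet G c′ e′}
                 (𝔇 : RICDomain X p) (𝔇′ : RICDomain Y p′) :
                 Set (ℓ ⊔ c ⊔ e ⊔ p ⊔ c′ ⊔ e′ ⊔ p′) where
  private
    module 𝔇  = RICDomain 𝔇
    module 𝔇′ = RICDomain 𝔇′
  field
    φ      : 𝔇.El → 𝔇′.El
    φ-cong : ∀ {x y} → x 𝔇.≈ᴱ y → φ x 𝔇′.≈ᴱ φ y
    φ-D    : ∀ ⋆ {x y} → 𝔇.Dᴱ ⋆ x y → 𝔇′.Dᴱ ⋆ (φ x) (φ y)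
    φ-act  : ∀ g x → g 𝔇′.·ᴱ φ x 𝔇′.≈ᴱ φ (g 𝔇.·ᴱ x)

pullback : ∀ {ℓ c e p c′ e′ p′ a : Level} {G : Group ℓ ℓ} {X : GSet G c e} {Y : GSet G c′ e′}
           {𝔇 : RICDomain X p} {𝔇′ : RICDomain Y p′} →
           DomainMap 𝔇 𝔇′ → RICFunctor 𝔇′ a → RICFunctor 𝔇 a
pullback {G = G} {X} {Y} {𝔇} {𝔇′} f Φ = record
  { Obj     = λ x → Obj (φ x)
  ; tr      = λ x y q → tr (φ x) (φ y) (φ-cong q)
  ; res     = λ y x q → res (φ y) (φ x) (φ-D 𝔯 q)
  ; ind     = λ x y q → ind (φ x) (φ y) (φ-D 𝔦 q)
  ; con     = λ g x → tr (g 𝔇′.·ᴱ φ x) (φ (g 𝔇.·ᴱ x)) (φ-act g x) ∘ₜ con g (φ x)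
  ; tr-id   = λ q → tr-id (φ-cong q)
  ; tr-∘    = λ q s t → tr-∘ (φ-cong q) (φ-cong s) (φ-cong t)
  ; res-tr  = λ q s t u → res-tr (φ-cong q) (φ-cong s) (φ-D 𝔯 t) (φ-D 𝔯 u)
  ; ind-tr  = λ q s t u → ind-tr (φ-cong q) (φ-cong s) (φ-D 𝔦 t) (φ-D 𝔦 u)
  ; con-tr  = λ {g} {g′} {x} {x′} g≈g′ q s m →
      let module A = TAb (Obj (φ (g′ 𝔇.·ᴱ x′)))
          s₁ = Y.·-cong g≈g′ (φ-cong q)
      in A.trans (tr-∘ (φ-act g x) (φ-cong s) (Y.trans (φ-act g x) (φ-cong s)) _)
        (A.trans (A.sym (tr-∘ s₁ (φ-act g′ x′) _ _))
                 (Hom.⟦⟧-cong (tr (g′ 𝔇′.·ᴱ φ x′) (φ (g′ 𝔇.·ᴱ x′)) (φ-act g′ x′))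
                              (con-tr g≈g′ (φ-cong q) s₁ m)))
  ; res-id  = λ q → res-id (φ-D 𝔯 q)
  ; ind-id  = λ q → ind-id (φ-D 𝔦 q)
  ; con-id  = λ x m →
      let module A = TAb (Obj (φ x))
      in A.trans (tr-∘ (φ-act G.ε x) _ (Y.·-identity _) _) (con-id (φ x) m)
  ; res-∘   = λ q s t → res-∘ (φ-D 𝔯 q) (φ-D 𝔯 s) (φ-D 𝔯 t)
  ; ind-∘   = λ q s t → ind-∘ (φ-D 𝔦 q) (φ-D 𝔦 s) (φ-D 𝔦 t)
  ; con-∘   = λ g′ g x m →
      let module A = TAb (Obj (φ ((g′ G.∙ g) 𝔇.·ᴱ x)))
          gx = g 𝔇.·ᴱ x
          s₁ = Y.·-cong (G.refl {g′}) (φ-act g x)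
          s₂ = φ-act g′ gx
          s₃ = φ-cong (X.·-assoc g′ g (proj₁ x))
          t₁ = Y.·-assoc g′ g (proj₁ (φ x))
          t₂ = φ-act (g′ G.∙ g) x
          n  = ⟦ con g (φ x) ⟧ m
          k  = ⟦ con g′ (g 𝔇′.·ᴱ φ x) ⟧ n
          w  = tr (φ (g′ 𝔇.·ᴱ gx)) (φ ((g′ G.∙ g) 𝔇.·ᴱ x)) s₃
               ∘ₜ tr (g′ 𝔇′.·ᴱ φ gx) (φ (g′ 𝔇.·ᴱ gx)) s₂
      in A.trans (Hom.⟦⟧-cong w (TAb.sym (Obj (g′ 𝔇′.·ᴱ φ gx)) (con-tr G.refl (φ-act g x) s₁ n)))
        (A.trans (tr-∘ s₂ s₃ (Y.trans s₂ s₃) (⟦ tr (g′ 𝔇′.·ᴱ g 𝔇′.·ᴱ φ x) (g′ 𝔇′.·ᴱ φ gx) s₁ ⟧ k))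
        (A.trans (tr-∘ s₁ (Y.trans s₂ s₃) (Y.trans s₁ (Y.trans s₂ s₃)) k)
        (A.trans (A.sym (tr-∘ t₁ t₂ (Y.trans s₁ (Y.trans s₂ s₃)) k))
                 (Hom.⟦⟧-cong (tr ((g′ G.∙ g) 𝔇′.·ᴱ φ x) (φ ((g′ G.∙ g) 𝔇.·ᴱ x)) t₂)
                              (con-∘ g′ g (φ x) m)))))
  ; con-res = λ g {x} {y} q s m →
      let module A = TAb (Obj (φ (g 𝔇.·ᴱ y)))
          q′ = 𝔇′.D-act⁺ 𝔯 g (proj₂ (φ x)) (φ-D 𝔯 q)
      in A.trans (Hom.⟦⟧-cong (tr (g 𝔇′.·ᴱ φ y) (φ (g 𝔇.·ᴱ y)) (φ-act g y)) (con-res g (φ-D 𝔯 q) q′ m))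
                 (res-tr (φ-act g x) (φ-act g y) q′ (φ-D 𝔯 s) _)
  ; con-ind = λ g {x} {y} q s m →
      let module A = TAb (Obj (φ (g 𝔇.·ᴱ x)))
          q′ = 𝔇′.D-act⁺ 𝔦 g (proj₂ (φ x)) (φ-D 𝔦 q)
      in A.trans (Hom.⟦⟧-cong (tr (g 𝔇′.·ᴱ φ x) (φ (g 𝔇.·ᴱ x)) (φ-act g x)) (con-ind g (φ-D 𝔦 q) q′ m))
                 (ind-tr (φ-act g x) (φ-act g y) q′ (φ-D 𝔦 s) _)
  }
  where
  module G  = Group G
  module X  = GSet X
  module Y  = GSet Y
  module 𝔇  = RICDomain 𝔇
  module 𝔇′ = RICDomain 𝔇′
  open DomainMap f
  open RICFunctor Φ

Subgroups : ∀ {ℓ} (G : Group ℓ ℓ) → GSet G (lsuc ℓ) ℓ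
Subgroups G = record
  { setoid     = record
    { Carrier       = Subgroup G
    ; _≈_           = _≈ˢ_
    ; isEquivalence = record { refl = ≐-refl ; sym = ≐-sym ; trans = ≐-trans }
    }
  ; _·_        = conj
  ; ·-cong     = λ {_} {_} {H} {K} → conj-cong {H = H} {K}
  ; ·-identity = conj-identity
  ; ·-assoc    = conj-conj
  }

module _ {ℓ : Level} {G : Group ℓ ℓ} where

  record IsSubgroupSystem (𝔖 : RawRICDomain (Subgroups G) (lsuc ℓ)) : Set (lsuc ℓ) where
    open RawRICDomain 𝔖
    field
      isRICDomain : IsRICDomain 𝔖
      D⇒≤         : ∀ ⋆ {H I} → b H → D ⋆ H I → I ≤ˢ H

  record _≤ᴰ_ (𝔖′ 𝔖 : RawRICDomain (Subgroups G) (lsuc ℓ)) : Set (lsuc ℓ) where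
    private
      module 𝔖  = RawRICDomain 𝔖
      module 𝔖′ = RawRICDomain 𝔖′
    field
      b⊆ : 𝔖′.b ⊆ 𝔖.b
      D⊆ : ∀ ⋆ {H} → 𝔖′.b H → 𝔖′.D ⋆ H ⊆ 𝔖.D ⋆ H

record SubgroupSystem {ℓ : Level} (G : Group ℓ ℓ) : Set (lsuc (lsuc ℓ)) where
  field
    raw              : RawRICDomain (Subgroups G) (lsuc ℓ)
    isSubgroupSystem : IsSubgroupSystem raw
  open IsSubgroupSystem isSubgroupSystem public using (D⇒≤)

  domain : RICDomain (Subgroups G) (lsuc ℓ)
  domain = record { raw = raw ; isRICDomain = IsSubgroupSystem.isRICDomain isSubgroupSystem }
  open RICDomain domain public hiding (raw)

restrict : ∀ {ℓ a} {G : Group ℓ ℓ} (𝔖′ 𝔖 : SubgroupSystem G) →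
           SubgroupSystem.raw 𝔖′ ≤ᴰ SubgroupSystem.raw 𝔖 →
           RICFunctor (SubgroupSystem.domain 𝔖) a → RICFunctor (SubgroupSystem.domain 𝔖′) a
restrict 𝔖′ 𝔖 𝔖′≤𝔖 = pullback record
  { φ      = λ (H , bH) → H , b⊆ bH
  ; φ-cong = λ e → e
  ; φ-D    = λ ⋆ {(H , bH)} → D⊆ ⋆ bH
  ; φ-act  = λ g x → ≐-refl
  }
  where open _≤ᴰ_ 𝔖′≤𝔖

record MackeySystem {ℓ : Level} (G : Group ℓ ℓ) : Set (lsuc (lsuc ℓ)) where
  field
    system : SubgroupSystem G
  open SubgroupSystem system public
  field
    finite : ∀ {H I J} → b H → D 𝔯 H I → D 𝔦 H J → Finite (DoubleCosets I H J)
    ∩-res  : ∀ {H I J} → b H → D 𝔯 H I → D 𝔦 H J → D 𝔯 J (I ∩ˢ J)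
    ∩-ind  : ∀ {H I J} → b H → D 𝔯 H I → D 𝔦 H J → D 𝔦 I (I ∩ˢ J)

  private module G = Group G

  ∩ˡ-res : ∀ {H I J} → b H → D 𝔯 H I → D 𝔦 H J → ∀ {h} → mem H h → D 𝔯 J ((I ^ˢ h) ∩ˢ J)
  ∩ˡ-res {H} bH rI iJ {h} Hh =
    ∩-res bH (D-resp 𝔯 (conj-self H (Subgroup.⁻¹-closed H Hh)) ≐-refl (D-act⁺ 𝔯 (h G.⁻¹) bH rI)) iJ

  ∩ʳ-ind : ∀ {H I J} → b H → D 𝔯 H I → D 𝔦 H J → ∀ {h} → mem H h → D 𝔦 I (I ∩ˢ conj h J)
  ∩ʳ-ind {H} bH rI iJ {h} Hh =
    ∩-ind bH rI (D-resp 𝔦 (conj-self H Hh) ≐-refl (D-act⁺ 𝔦 h bH iJ))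

module _ {ℓ a : Level} {G : Group ℓ ℓ} (𝔐 : MackeySystem G)
         (C : RICFunctor (MackeySystem.domain 𝔐) a) where
  open MackeySystem 𝔐
  open RICFunctor C

  -- ind_{I,I∩ʰJ} con_{h,Iʰ∩J} res_{Iʰ∩J,J}, where ʰ(Iʰ∩J) = I∩ʰJ
  summand : ∀ (x@(H , _) y z : El) → Dᴱ 𝔯 x y → Dᴱ 𝔦 x z → ∃ (mem H) → Hom (Obj z) (Obj y)
  summand (H , bH) y@(I , bI) z@(J , bJ) rI iJ (h , Hh) =
    ind y w i ∘ₜ tr (h ·ᴱ v) w (conj-∩ h I J) ∘ₜ con h v ∘ₜ res v z r
    where
    r : D 𝔯 J ((I ^ˢ h) ∩ˢ J)
    r = ∩ˡ-res bH rI iJ Hh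
    i : D 𝔦 I (I ∩ˢ conj h J)
    i = ∩ʳ-ind bH rI iJ Hh
    v w : El
    v = (I ^ˢ h) ∩ˢ J , D⊆b 𝔯 bJ r
    w = I ∩ˢ conj h J , D⊆b 𝔦 bI i

  record IsMackeyFunctor : Set (lsuc ℓ ⊔ a) where
    field
      con-self : ∀ {h} (x@(H , _) : El) (Hh : mem H h) →
                 tr (h ·ᴱ x) x (conj-self H Hh) ∘ₜ con h x ≋ idₜ
      mackey   : ∀ (x@(H , _) y@(I , _) z@(J , _) : El) (rI : Dᴱ 𝔯 x y) (iJ : Dᴱ 𝔦 x z)
                 {n} (R : Enumeration (DoubleCosets I H J) n) (m : TAb.Carrier (Obj z)) →
                 let open TAb (Obj y) using (_≈_; commutativeMonoid)
                     open Sum commutativeMonoid using (sum)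
                 in ⟦ res y x rI ∘ₜ ind x z iJ ⟧ m
                    ≈ sum {n} λ k → ⟦ summand x y z rI iJ (Bijection.to R k) ⟧ m

record MackeyFunctor {ℓ : Level} {G : Group ℓ ℓ} (𝔐 : MackeySystem G) (a : Level) :
                     Set (lsuc ℓ ⊔ lsuc (lsuc a)) where
  field
    functor         : RICFunctor (MackeySystem.domain 𝔐) a
    isMackeyFunctor : IsMackeyFunctor 𝔐 functor

SubgroupPairs : ∀ {ℓ} (G : Group ℓ ℓ) → GSet G (lsuc ℓ) ℓ
SubgroupPairs G = record
  { setoid     = ×-setoid S.setoid S.setoid
  ; _·_        = λ g (H , U) → g S.· H , g S.· U
  ; ·-cong     = λ {_} {_} {(H , U)} {(H′ , U′)} e (H≈H′ , U≈U′) →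
                   S.·-cong {x = H} {H′} e H≈H′ , S.·-cong {x = U} {U′} e U≈U′
  ; ·-identity = λ (H , U) → S.·-identity H , S.·-identity U
  ; ·-assoc    = λ g h (H , U) → S.·-assoc g h H , S.·-assoc g h U
  }
  where module S = GSet (Subgroups G)

record TwoDimensionalSubgroupSystem {ℓ : Level} (G : TopologicalGroup ℓ) : Set (lsuc (lsuc ℓ)) where
  private module G = TopologicalGroup G
  field
    domain : RICDomain (SubgroupPairs G.group) (lsuc ℓ)
  open RICDomain domain public
  field
    closed        : ∀ {H U} → b (H , U) → G.Closed (mem H)
    closed-normal : ∀ {H U} → b (H , U) → mem U G.ClosedIn mem H × U ⊴ H
    D⇒≤           : ∀ ⋆ {H U I V} → b (H , U) → D ⋆ (H , U) (I , V) → I ≤ˢ H × V ≤ˢ U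

  Ext : Subgroup G.group → Pred (Subgroup G.group) (lsuc ℓ)
  Ext H U = b (H , U)

  flat : RawRICDomain (Subgroups G.group) (lsuc ℓ)
  flat = record
    { b      = λ H → ∃ λ U → b (H , U)
    ; b-resp = λ e (U , bHU) → U , b-resp (e , ≐-refl) bHU
    ; D      = λ ⋆ H I → ∃₂ λ U V → b (H , U) × D ⋆ (H , U) (I , V)
    ; D-resp = λ ⋆ e f (U , V , bHU , d) →
                 U , V , b-resp (e , ≐-refl) bHU , D-resp ⋆ (e , ≐-refl) (f , ≐-refl) d
    }

record Spectrum {ℓ : Level} (G : TopologicalGroup ℓ) : Set (lsuc (lsuc ℓ)) where
  field
    twoDimensional : TwoDimensionalSubgroupSystem G
  open TwoDimensionalSubgroupSystem twoDimensional public
  private module flat = RawRICDomain flat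
  field
    flat-isSubgroupSystem : IsSubgroupSystem flat
    D𝔯⇒≈         : ∀ {H U I V} → b (H , U) → D 𝔯 (H , U) (I , V) → V ≈ˢ U
    finite-index : ∀ {H I} → flat.b H → flat.D 𝔯 H I → Finite (LeftCosets H I)

  flatSystem : SubgroupSystem (TopologicalGroup.group G)
  flatSystem = record { raw = flat ; isSubgroupSystem = flat-isSubgroupSystem }

module _ {ℓ : Level} {G : TopologicalGroup ℓ} (𝔈 : Spectrum G) where
  private module 𝔈 = Spectrum 𝔈

  -- B ↦ B^𝔈
  lift : ∀ {a} → RICFunctor (SubgroupSystem.domain 𝔈.flatSystem) a → RICFunctor 𝔈.domain a
  lift = pullback record
    { φ      = λ ((H , U) , bHU) → H , U , bHU
    ; φ-cong = proj₁
    ; φ-D    = λ ⋆ {((H , U) , bHU)} {((I , V) , _)} d → U , V , bHU , d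
    ; φ-act  = λ g x → ≐-refl
    }

  -- F = B^𝔈 / Φ for some B and some subfunctor Φ of B^𝔈
  IsRepresentation : ∀ {a} → RICFunctor 𝔈.domain a → Set (lsuc ℓ ⊔ lsuc (lsuc a))
  IsRepresentation {a} F =
    Σ[ B ∈ RICFunctor (SubgroupSystem.domain 𝔈.flatSystem) a ]
    Σ[ Φ ∈ (∀ x → SubgroupOf (RICFunctor.Obj (lift B) x)) ]
    Σ[ isSubfunctor ∈ IsSubfunctor (lift B) Φ ]
    F ≡ quotientFunctor (lift B) Φ isSubfunctor

  record MackeyCover : Set (lsuc (lsuc ℓ)) where
    field
      mackeySystem : MackeySystem (TopologicalGroup.group G)
    open MackeySystem mackeySystem public
    field
      flat≤ : 𝔈.flat ≤ᴰ raw
      Ext⊆  : ∀ {H} → RawRICDomain.b 𝔈.flat H → 𝔈.Ext H ⊆ D 𝔦 H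
      D𝔦⊆   : ∀ {H U I V} → 𝔈.b (H , U) → 𝔈.D 𝔦 (H , U) (I , V) → D 𝔦 U V

  module _ (𝔐 : MackeyCover) {a : Level}
           (C : RICFunctor (MackeyCover.domain 𝔐) a) where
    private module 𝔐 = MackeyCover 𝔐
    open _≤ᴰ_ 𝔐.flat≤

    -- C^𝔈, with C first restricted along 𝔈♭ ≤ 𝔐
    liftC : RICFunctor 𝔈.domain a
    liftC = lift (restrict 𝔈.flatSystem 𝔐.system 𝔐.flat≤ C)

    -- ind^C_𝔈
    indC : ∀ x → SubgroupOf (RICFunctor.Obj liftC x)
    indC ((H , U) , bHU) = image (RICFunctor.ind C (H , bH) (U , 𝔐.D⊆b 𝔦 bH iU) iU)
      where
      bH : 𝔐.b H
      bH = b⊆ (U , bHU)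
      iU : 𝔐.D 𝔦 H U
      iU = 𝔐.Ext⊆ (U , bHU) bHU

{-# OPTIONS --safe #-}

-- Stability under con and ind is functoriality of C.  For res, let (I,U) be a
-- restriction of (H,U).  The Mackey formula writes res_{I,H} ind_{H,U} as a
-- sum of maps factoring through ind_{I,I∩ʰU} with h ∈ H, and I ∩ ʰU = U
-- because U is normal in H and contained in I.
module Submission where

open import Algebra.Bundles using (Group)
import Algebra.Properties.CommutativeMonoid.Sum as Sum
open import Data.Fin.Base using (zero; suc)
open import Data.Nat.Base using (zero; suc)
open import Data.Product.Base using (Σ-syntax; _,_; proj₁; proj₂)
open import Function.Base using (_∘_)
open import Function.Bundles using (Bijection)
open import Level using (Level)
open import Relation.Binary.PropositionalEquality.Core using (refl)
open import Relation.Unary.Properties using (≐-refl; ≐-trans)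
open import Defs
open Subgroup using (mem)
open Hom using (⟦_⟧; ⟦⟧-cong)

sum-closed : ∀ {a} {A : TAb a} (N : SubgroupOf A) → let open Sum (TAb.commutativeMonoid A) in
             ∀ {n} f → (∀ k → mem N (f k)) → mem N (sum {n} f)
sum-closed N {zero}  f Nf = Subgroup.ε-closed N
sum-closed {A = A} N {suc n} f Nf =
  Subgroup.∙-closed N (Nf zero) (sum-closed {A = A} N (f ∘ suc) (Nf ∘ suc))

-- Normality under `h` gives ʰU ≤ U; normality under `h⁻¹` gives the converse.
∩-conj-normal : ∀ {ℓ} {G : Group ℓ ℓ} {H I U : Subgroup G} → U ⊴ H → U ≤ˢ I →
                ∀ {h} → mem H h → (I ∩ˢ conj h U) ≈ˢ U
∩-conj-normal {G = G} {H} {I} {U} (_ , normal) U≤I {h} Hh =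
  (λ (_ , _ , Uu , x≈) → U.resp (G.sym x≈) (normal Hh Uu)) ,
  (λ Ux → U≤I Ux , U≤hU Ux)
  where
  module G = Group G
  module H = Subgroup H
  module U = Subgroup U
  U≤hU : U ≤ˢ conj h U
  U≤hU Ux =
    -- Writing U as the `h`-conjugate of its `h⁻¹`-conjugate yields `y` in the latter, which
    -- normality puts back in U.
    let y , (_ , Uu , y≈) , x≈ = proj₂ (≐-trans (conj-conj h (h G.⁻¹) U)
          (≐-trans (conj-cong {H = U} {U} (G.inverseʳ h) ≐-refl) (conj-identity U))) Ux
    in y , U.resp (G.sym y≈) (normal (H.⁻¹-closed Hh) Uu) , x≈

module _ {ℓ c e p a : Level} {G : Group ℓ ℓ} {X : GSet G c e} {𝔇 : RICDomain X p}
         (Φ : RICFunctor 𝔇 a) where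
  open RICDomain 𝔇
  open RICFunctor Φ
  private module X = GSet X

  tr-image-ind : ∀ {x x′ y y′} (s : x ≈ᴱ x′) → y ≈ᴱ y′ → (q : Dᴱ 𝔦 x y) (q′ : Dᴱ 𝔦 x′ y′) →
                 ∀ {m} → mem (image (ind x y q)) m → mem (image (ind x′ y′ q′)) (⟦ tr x x′ s ⟧ m)
  tr-image-ind {x} {x′} {y} {y′} s t q q′ (n , e) =
    ⟦ tr y y′ t ⟧ n ,
    TAb.trans (Obj x′) (TAb.sym (Obj x′) (ind-tr s t q q′ n)) (⟦⟧-cong (tr x x′ s) e)

  -- Transport along a reflexive equality at `x` is the identity by `tr-id`, so `tr-image-ind`
  -- becomes an inclusion of images in one fixed group.
  image-ind-resp : ∀ {x y y′} → y ≈ᴱ y′ → (q : Dᴱ 𝔦 x y) (q′ : Dᴱ 𝔦 x y′) →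
                   image (ind x y q) ≤ˢ image (ind x y′ q′)
  image-ind-resp {x} {y} {y′} t q q′ {m} im =
    Subgroup.resp (image (ind x y′ q′)) (tr-id X.refl m) (tr-image-ind X.refl t q q′ im)

  con-image-ind : ∀ g {x y} (q : Dᴱ 𝔦 x y) (q′ : Dᴱ 𝔦 (g ·ᴱ x) (g ·ᴱ y)) → ∀ {m} →
                  mem (image (ind x y q)) m → mem (image (ind (g ·ᴱ x) (g ·ᴱ y) q′)) (⟦ con g x ⟧ m)
  con-image-ind g {x} {y} q q′ (n , e) =
    ⟦ con g y ⟧ n ,
    TAb.trans (Obj (g ·ᴱ x)) (TAb.sym (Obj (g ·ᴱ x)) (con-ind g q q′ n)) (⟦⟧-cong (con g x) e)

  -- Both ways from `v` up to `x` compose to the same induction: through `y` and through `u`.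
  ind-image-ind : ∀ {x y u v} (xy : Dᴱ 𝔦 x y) (yv : Dᴱ 𝔦 y v) (xu : Dᴱ 𝔦 x u) (uv : Dᴱ 𝔦 u v) →
                  ∀ {m} → mem (image (ind y v yv)) m → mem (image (ind x u xu)) (⟦ ind x y xy ⟧ m)
  ind-image-ind {x} {y} {u} {v} xy yv xu uv (n , e) =
    ⟦ ind u v uv ⟧ n ,
    A.trans (ind-∘ xu uv xv n) (A.trans (A.sym (ind-∘ xy yv xv n)) (⟦⟧-cong (ind x y xy) e))
    where
    module A = TAb (Obj x)
    xv = D-trans 𝔦 (proj₂ x) xu uv

module _ {ℓ a : Level} {G : Group ℓ ℓ} {𝔐 : MackeySystem G} (C : MackeyFunctor 𝔐 a) where
  open MackeySystem 𝔐
  open MackeyFunctor C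
  open RICFunctor functor
  open IsMackeyFunctor isMackeyFunctor

  -- `v` is kept apart from `u` because restriction in a spectrum fixes the second component only up
  -- to `≈ˢ`.
  res-image-ind : ∀ {x y u v : El} → proj₁ u ⊴ proj₁ x → proj₁ u ≤ˢ proj₁ y → u ≈ᴱ v →
                  (xy : Dᴱ 𝔯 x y) (xu : Dᴱ 𝔦 x u) (yv : Dᴱ 𝔦 y v) → ∀ {m} →
                  mem (image (ind x u xu)) m → mem (image (ind y v yv)) (⟦ res y x xy ⟧ m)
  res-image-ind {x@(H , bH)} {y@(I , bI)} {u@(U , bU)} {v} U⊴H U≤I u≈v xy xu yv (m , e) =
    let _ , R = finite bH xy xu in
    N.resp (A.trans (A.sym (mackey x y u xy xu R m)) (⟦⟧-cong (res y x xy) e))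
           (sum-closed {A = Obj y} N _ λ k → summand∈N (Bijection.to R k))
    where
    module A = TAb (Obj y)
    N = image (ind y v yv)
    module N = Subgroup N
    summand∈N : ∀ h → mem N (⟦ summand 𝔐 functor x y u xy xu h ⟧ m)
    -- The outermost map of the summand is induction from I ∩ ʰU, so its argument is the preimage; I
    -- ∩ ʰU is then replaced by `v`.
    summand∈N (h , Hh) = image-ind-resp functor
      (≐-trans (∩-conj-normal {H = H} {I} {U} U⊴H U≤I Hh) u≈v) (∩ʳ-ind bH xy xu Hh) yv (_ , A.refl)

module _ {ℓ a : Level} {G : TopologicalGroup ℓ} (𝔈 : Spectrum G) (𝔐 : MackeyCover 𝔈)
         (C : MackeyFunctor (MackeyCover.mackeySystem 𝔐) a) where
  private
    module 𝔈 = Spectrum 𝔈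
    module 𝔐 = MackeyCover 𝔐
    open MackeyFunctor C using (functor)
    open _≤ᴰ_ 𝔐.flat≤

    Ext-ind : ∀ {H U} → 𝔈.b (H , U) → 𝔐.D 𝔦 H U
    Ext-ind {_} {U} bHU = 𝔐.Ext⊆ (U , bHU) bHU

  indC-isSubfunctor : IsSubfunctor (liftC 𝔈 𝔐 functor) (indC 𝔈 𝔐 functor)
  indC-isSubfunctor = record
    { tr-stable  = λ { {_ , bHU} {_ , bIV} (H≈I , U≈V) →
        tr-image-ind functor H≈I U≈V (Ext-ind bHU) (Ext-ind bIV) }
    ; res-stable = λ { {(H , U) , bHU} {(I , V) , bIV} q →
        -- The inclusion U ≤ I comes from U = V together with V ⊴ I.
        let V≤U , U≤V = 𝔈.D𝔯⇒≈ bHU q in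
        res-image-ind C (proj₂ (𝔈.closed-normal bHU))
          (proj₁ (proj₂ (𝔈.closed-normal bIV)) ∘ U≤V) (U≤V , V≤U)
          (D⊆ 𝔯 (U , bHU) (U , V , bHU , q)) (Ext-ind bHU) (Ext-ind bIV) }
    ; ind-stable = λ { {(H , U) , bHU} {(I , V) , bIV} q →
        -- The inner induction from V to U exists by the last condition on a Mackey cover.
        ind-image-ind functor (D⊆ 𝔦 (U , bHU) (U , V , bHU , q)) (Ext-ind bIV) (Ext-ind bHU)
          (𝔐.D𝔦⊆ bHU q) }
    ; con-stable = λ { g {(H , U) , bHU} im →
        let bH  = b⊆ (U , bHU)
            iU  = Ext-ind bHU
            igU = 𝔐.D-act⁺ 𝔦 g bH iU
            iV  = Ext-ind (𝔈.b-act g bHU)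
            gU  = g 𝔐.·ᴱ (U , 𝔐.D⊆b 𝔦 bH iU)
        -- Conjugation in `liftC` is that of C followed by two transports along `≐-refl`, one for
        -- each pullback (`restrict`, then `lift`). The first also exchanges `igU` for `iV`, the
        -- second exchanges `gU` for the copy of ᵍU used by `indC`, which carries another proof of
        -- membership in the base.
        in tr-image-ind functor {y = gU} ≐-refl ≐-refl iV iV
             (tr-image-ind functor ≐-refl ≐-refl igU iV
               (con-image-ind functor g iU igU im)) }
    }

quotient-isRepresentation : ∀ {ℓ a} {G : TopologicalGroup ℓ} (𝔈 : Spectrum G)
  (B : RICFunctor (SubgroupSystem.domain (Spectrum.flatSystem 𝔈)) a)
  (Φ : ∀ x → SubgroupOf (RICFunctor.Obj (lift 𝔈 B) x)) (isSubfunctor : IsSubfunctor (lift 𝔈 B) Φ) →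
  IsRepresentation 𝔈 (quotientFunctor (lift 𝔈 B) Φ isSubfunctor)
quotient-isRepresentation 𝔈 B Φ isSubfunctor = B , Φ , isSubfunctor , refl

proposition3p3p8 : {ℓ a : Level} (G : TopologicalGroup ℓ) (𝔈 : Spectrum G) (𝔐 : MackeyCover 𝔈)
    (C : MackeyFunctor (MackeyCover.mackeySystem 𝔐) a) →
    let open MackeyFunctor C using (functor) in
    Σ[ isSubfunctor ∈ IsSubfunctor (liftC 𝔈 𝔐 functor) (indC 𝔈 𝔐 functor) ]
    IsRepresentation 𝔈 (quotientFunctor (liftC 𝔈 𝔐 functor) (indC 𝔈 𝔐 functor) isSubfunctor)
proposition3p3p8 G 𝔈 𝔐 C =
  indC-isSubfunctor 𝔈 𝔐 C ,
  -- The representing B is the restriction of C to 𝔈♭; `liftC` is its lift by definition.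
  quotient-isRepresentation 𝔈 (restrict (Spectrum.flatSystem 𝔈) 𝔐.system 𝔐.flat≤ functor)
    (indC 𝔈 𝔐 functor) (indC-isSubfunctor 𝔈 𝔐 C)
  where
  module 𝔐 = MackeyCover 𝔐
  open MackeyFunctor C using (functor)
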